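{- Let $K_{m_1,m_2}$ be the complete bipartite graph with bipartition $(X,Y)$, $X=\{x_1,\dots,x_{m_1}\}$, $Y=\{y_1,\dots,y_{m_2}\}$, where $2\le m_1\le m_2$. Let $s$ and $i$ be integers with $\max\{1,s-m_2\}\le i\le \min\{m_1,s-1\}$ and $s\ge m_2-m_1+3$, and let $S_i=\{x_1,\dots,x_i,y_1,\dots,y_{s-i}\}$. If $2\le 2i\le m_1+s-m_2$, then $$\kappa^*_{K_{m_1,m_2}}(S_i)\ge\begin{cases} m_1-i, & \text{if } 2\le 2i\le \frac{2(m_1+s-m_2)}{3},\\[2pt] m_2-(s-i)+\left\lfloor\frac{m_1+s-m_2-i}{2}\right\rfloor, & \text{if } \frac{2(m_1+s-m_2)}{3}<2i\le m_1+s-m_2.\end{cases}$$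
   Context: For $S\subseteq V(G)$ with $|S|\ge 2$, an $S$-Steiner tree of $G$ is a subtree $T$ of $G$ with $S\subseteq V(T)$ all of whose leaves belong to $S$. A family of $S$-Steiner trees $T_1,\dots,T_k$ is completely independent if for all $1\le p<q\le k$: $E(T_p)\cap E(T_q)=\emptyset$, $V(T_p)\cap V(T_q)=S$, and for any two vertices $x_1,x_2\in S$ the $(x_1,x_2)$-paths in $T_p$ and in $T_q$ are internally disjoint. $\kappa^*_G(S)$ is the maximum number of trees in a completely independent family of $S$-Steiner trees in $G$. -}

module Defs where

open import Data.Bool using (Bool; true; false)
open import Data.Empty using (⊥)
open import Data.Fin using (Fin; zero; suc; toℕ; fromℕ<; splitAt; combine)
import Data.Fin as Fin
import Data.Fin.Properties as Fin
open import Data.Fin.Subset using (Subset; inside; outside; _∈_; _⊆_; _∩_; ∣_∣; Nonempty)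
open import Data.Fin.Subset.Properties using (_∈?_; _⊆?_; nonempty?; anySubset?)
open import Data.List using (List; []; _∷_; length; head; last)
import Data.List as List
open import Data.List.Membership.Propositional using () renaming (_∈_ to _∈ₗ_)
import Data.List.Membership.DecPropositional as DecMembership
open import Data.List.Membership.Propositional.Properties using (∈-lookup)
open import Data.List.Relation.Unary.All using (All; []; _∷_)
import Data.List.Relation.Unary.All as All
open import Data.List.Relation.Unary.AllPairs using ([]; _∷_)
open import Data.List.Relation.Unary.Linked using (Linked; []; [-]; _∷_; linked?)
open import Data.List.Relation.Unary.Unique.Propositional using (Unique)
import Data.List.Relation.Unary.Unique.DecPropositional as DecUnique
open import Data.Maybe using (just; is-just)
open import Data.Maybe.Properties using () renaming (≡-dec to maybe-≡-dec)
open import Data.Nat using (ℕ; zero; suc; _+_; _*_; _∸_; _≤_; _<_; z≤n; s≤s; _≤?_; _<?_)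
import Data.Nat.Properties as ℕ
open import Data.Product using (Σ; ∃; ∃-syntax; _×_; _,_; proj₁; proj₂; uncurry)
open import Data.Sum using (isInj₁)
open import Data.Vec using (Vec; []; _∷_; _++_; here; there; lookup; tabulate; toList; fromList)
open import Data.Vec.Properties using (toList∘fromList) renaming (≡-dec to vec-≡-dec)
open import Data.Bool.Properties using () renaming (_≟_ to _≟ᵇ_)
open import Function using (_∘_)
open import Relation.Binary.Definitions using (Tri; tri<; tri≈; tri>)
open import Relation.Binary.PropositionalEquality using (_≡_; _≢_; refl; sym; cong; subst)
open import Relation.Nullary using (¬_; Dec; yes; no; does; contradiction)
open import Relation.Nullary.Decidable using (map′; _×-dec_; _→-dec_; ¬?; decidable-stable)
open import Relation.Unary using (Decidable)

private
  variable
    n k : ℕ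

------------------------------------------------------------------------
-- Graphs and subgraphs

record SimpleGraph (n : ℕ) : Set₁ where
  field
    Adj        : Fin n → Fin n → Set
    adj?       : ∀ u v → Dec (Adj u v)
    adj-sym    : ∀ {u v} → Adj u v → Adj v u
    adj-irrefl : ∀ {u} → ¬ Adj u u

-- Raw data of a candidate subgraph: a vertex set and an adjacency matrix
-- whose row v is the neighbourhood of v.  `IsSubgraph` below says when the
-- data describe a subgraph.
record Subgraph (n : ℕ) : Set where
  constructor subgraph
  field
    verts : Subset n
    nbrs  : Vec (Subset n) n

open Subgraph public

Edge : Subgraph n → Fin n → Fin n → Set
Edge T u v = v ∈ lookup (nbrs T) u

degree : Subgraph n → Fin n → ℕ
degree T v = ∣ lookup (nbrs T) v ∣

record IsSubgraph (G : SimpleGraph n) (T : Subgraph n) : Set where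
  field
    edge⇒adj   : ∀ u v → Edge T u v → SimpleGraph.Adj G u v
    edge-sym   : ∀ u v → Edge T u v → Edge T v u
    edge⇒verts : ∀ u v → Edge T u v → u ∈ verts T

------------------------------------------------------------------------
-- Paths and trees

-- A path is given by its sequence of vertices.
record IsPath (T : Subgraph n) (u v : Fin n) (vs : List (Fin n)) : Set where
  field
    starts   : head vs ≡ just u
    ends     : last vs ≡ just v
    inside-T : All (_∈ verts T) vs
    linked   : Linked (Edge T) vs
    unique   : Unique vs

Internal : (u v : Fin n) → List (Fin n) → Fin n → Set
Internal u v vs w = w ∈ₗ vs × w ≢ u × w ≢ v

Connected : Subgraph n → Set
Connected T = ∀ u v → u ∈ verts T → v ∈ verts T → ∃[ vs ] IsPath T u v vs

-- A cycle is a path on at least three vertices whose ends are adjacent.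
HasCycle : Subgraph n → Set
HasCycle T = ∃[ u ] ∃[ v ] ∃[ vs ] (IsPath T u v vs × 3 ≤ length vs × Edge T v u)

IsTree : Subgraph n → Set
IsTree T = Nonempty (verts T) × Connected T × ¬ HasCycle T

Leaf : Subgraph n → Fin n → Set
Leaf T v = v ∈ verts T × degree T v ≡ 1

------------------------------------------------------------------------
-- Steiner trees

record IsSteinerTree (G : SimpleGraph n) (S : Subset n) (T : Subgraph n) : Set where
  field
    isSubgraph : IsSubgraph G T
    isTree     : IsTree T
    spans      : S ⊆ verts T
    leaves     : ∀ v → Leaf T v → v ∈ S

EdgeDisjoint : Subgraph n → Subgraph n → Set
EdgeDisjoint T T′ = ∀ u v → ¬ (Edge T u v × Edge T′ u v)

InternallyDisjoint : (T T′ : Subgraph n) (u v : Fin n) → Set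
InternallyDisjoint T T′ u v = ∀ vs vs′ → IsPath T u v vs → IsPath T′ u v vs′ →
  ∀ w → ¬ (Internal u v vs w × Internal u v vs′ w)

record Independent (S : Subset n) (T T′ : Subgraph n) : Set where
  field
    edges : EdgeDisjoint T T′
    verts∩ : verts T ∩ verts T′ ≡ S
    paths : ∀ u v → u ∈ S → v ∈ S → u ≢ v → InternallyDisjoint T T′ u v

record CompletelyIndependent (G : SimpleGraph n) (S : Subset n)
                             (Ts : Vec (Subgraph n) k) : Set where
  field
    steiner     : ∀ p → IsSteinerTree G S (lookup Ts p)
    independent : ∀ p q → p Fin.< q → Independent S (lookup Ts p) (lookup Ts q)

HasFamily : SimpleGraph n → Subset n → ℕ → Set
HasFamily {n} G S k = Σ (Vec (Subgraph n) k) (CompletelyIndependent G S)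

IsMaximum : (ℕ → Set) → ℕ → Set
IsMaximum P k = P k × (∀ j → P j → j ≤ k)

------------------------------------------------------------------------
-- Decidability of `HasFamily`, by exhaustive search.  It is used only to
-- make the maximum κ* a number rather than a relation.

Searchable : Set → Set₁
Searchable A = ∀ {P : A → Set} → Decidable P → Dec (∃ P)

private
  search-map : {A B : Set} (f : A → B) (g : B → A) → (∀ b → f (g b) ≡ b) →
               Searchable A → Searchable B
  search-map f g fg s {P} P? = map′ (λ (a , p) → f a , p)
    (λ (b , p) → g b , subst P (sym (fg b)) p) (s (P? ∘ f))

  search-× : {A B : Set} → Searchable A → Searchable B → Searchable (A × B)
  search-× s t P? = map′ (λ (a , b , p) → (a , b) , p) (λ ((a , b) , p) → a , b , p)
    (s (λ a → t (λ b → P? (a , b))))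

  search-vec : {A : Set} → Searchable A → ∀ m → Searchable (Vec A m)
  search-vec s zero    P? = map′ ([] ,_) (λ { ([] , p) → p }) (P? [])
  search-vec s (suc m) P? =
    map′ (λ (a , as , p) → a ∷ as , p) (λ { (a ∷ as , p) → a , as , p })
      (s (λ a → search-vec s m (λ as → P? (a ∷ as))))

  search-subgraph : Searchable (Subgraph n)
  search-subgraph {n} = search-map (uncurry subgraph) (λ T → verts T , nbrs T) (λ _ → refl)
    (search-× anySubset? (search-vec anySubset? n))

  lookup-injective : {A : Set} {xs : List A} → Unique xs → ∀ i j →
                     List.lookup xs i ≡ List.lookup xs j → i ≡ j
  lookup-injective (_ ∷ _)  zero    zero    _  = refl
  lookup-injective (d ∷ _)  zero    (suc j) eq = contradiction eq (All.lookup d (∈-lookup j))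
  lookup-injective (d ∷ _)  (suc i) zero    eq = contradiction (sym eq) (All.lookup d (∈-lookup i))
  lookup-injective (_ ∷ us) (suc i) (suc j) eq = cong suc (lookup-injective us i j eq)

  unique-length : {xs : List (Fin n)} → Unique xs → length xs ≤ n
  unique-length us = Fin.injective⇒≤ (λ {i} {j} → lookup-injective us i j)

  search-unique : {P : List (Fin n) → Set} → (∀ {vs} → P vs → Unique vs) →
                  Decidable P → Dec (∃ P)
  search-unique {n} {P} P⇒unique P? = map′
    (λ (_ , v , p) → toList v , p)
    (λ (vs , p) → index vs (s≤s (unique-length (P⇒unique p))) p)
    (Fin.any? {n = suc n} (λ m → search-vec Fin.any? (toℕ m) (P? ∘ toList)))
    where
    index : ∀ vs → length vs < suc n → P vs →
            ∃[ m ] Σ (Vec (Fin n) (toℕ {suc n} m)) (P ∘ toList)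
    index vs l p = fromℕ< l ,
      subst (λ j → Σ (Vec (Fin n) j) (P ∘ toList)) (sym (Fin.toℕ-fromℕ< l))
        (fromList vs , subst P (sym (toList∘fromList vs)) p)

edge? : (T : Subgraph n) → ∀ u v → Dec (Edge T u v)
edge? T u v = v ∈? lookup (nbrs T) u

isPath? : (T : Subgraph n) → ∀ u v → Decidable (IsPath T u v)
isPath? T u v vs = map′
  (λ (a , b , c , d , e) → record
    { starts = a ; ends = b ; inside-T = c ; linked = d ; unique = e })
  (λ p → let open IsPath p in starts , ends , inside-T , linked , unique)
  (maybe-≡-dec Fin._≟_ (head vs) (just u) ×-dec
   maybe-≡-dec Fin._≟_ (last vs) (just v) ×-dec
   All.all? (_∈? verts T) vs ×-dec
   linked? (edge? T) vs ×-dec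
   DecUnique.unique? Fin._≟_ vs)

isTree? : Decidable (IsTree {n})
isTree? T =
  nonempty? (verts T) ×-dec
  Fin.all? (λ u → Fin.all? λ v → (u ∈? verts T) →-dec (v ∈? verts T) →-dec
    search-unique IsPath.unique (isPath? T u v)) ×-dec
  ¬? (Fin.any? λ u → Fin.any? λ v → search-unique (IsPath.unique ∘ proj₁)
    (λ vs → isPath? T u v vs ×-dec (3 ≤? length vs) ×-dec edge? T v u))

isSubgraph? : (G : SimpleGraph n) → Decidable (IsSubgraph G)
isSubgraph? G T = map′
  (λ (a , b , c) → record { edge⇒adj = a ; edge-sym = b ; edge⇒verts = c })
  (λ r → let open IsSubgraph r in edge⇒adj , edge-sym , edge⇒verts)
  (Fin.all? (λ u → Fin.all? λ v → edge? T u v →-dec SimpleGraph.adj? G u v) ×-dec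
   Fin.all? (λ u → Fin.all? λ v → edge? T u v →-dec edge? T v u) ×-dec
   Fin.all? (λ u → Fin.all? λ v → edge? T u v →-dec (u ∈? verts T)))

isSteinerTree? : (G : SimpleGraph n) (S : Subset n) → Decidable (IsSteinerTree G S)
isSteinerTree? G S T with isSubgraph? G T | isTree? T | S ⊆? verts T |
  Fin.all? (λ v → ((v ∈? verts T) ×-dec (degree T v ℕ.≟ 1)) →-dec (v ∈? S))
... | no ¬a | _     | _     | _     = no (¬a ∘ IsSteinerTree.isSubgraph)
... | yes _ | no ¬b | _     | _     = no (¬b ∘ IsSteinerTree.isTree)
... | yes _ | yes _ | no ¬c | _     = no (λ r → ¬c (IsSteinerTree.spans r))
... | yes _ | yes _ | yes _ | no ¬d = no (¬d ∘ IsSteinerTree.leaves)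
... | yes a | yes b | yes c | yes d =
  yes (record { isSubgraph = a ; isTree = b ; spans = c ; leaves = d })

internallyDisjoint? : (T T′ : Subgraph n) → ∀ u v → Dec (InternallyDisjoint T T′ u v)
internallyDisjoint? T T′ u v = map′
  (λ ¬c vs vs′ p p′ w i → ¬c (vs , p , vs′ , p′ , w , i))
  (λ d (vs , p , vs′ , p′ , w , i) → d vs vs′ p p′ w i)
  (¬? (search-unique (IsPath.unique ∘ proj₁) (λ vs → isPath? T u v vs ×-dec
    search-unique (IsPath.unique ∘ proj₁) (λ vs′ → isPath? T′ u v vs′ ×-dec
      Fin.any? (λ w → internal? vs w ×-dec internal? vs′ w)))))
  where
  internal? : ∀ vs w → Dec (Internal u v vs w)
  internal? vs w = DecMembership._∈?_ Fin._≟_ w vs ×-dec ¬? (w Fin.≟ u) ×-dec ¬? (w Fin.≟ v)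

independent? : (S : Subset n) → ∀ T T′ → Dec (Independent S T T′)
independent? S T T′ = map′
  (λ (a , b , c) → record { edges = a ; verts∩ = b ; paths = c })
  (λ r → let open Independent r in edges , verts∩ , paths)
  (Fin.all? (λ u → Fin.all? λ v → ¬? (edge? T u v ×-dec edge? T′ u v)) ×-dec
   vec-≡-dec _≟ᵇ_ (verts T ∩ verts T′) S ×-dec
   Fin.all? (λ u → Fin.all? λ v → (u ∈? S) →-dec (v ∈? S) →-dec ¬? (u Fin.≟ v) →-dec
     internallyDisjoint? T T′ u v))

hasFamily? : (G : SimpleGraph n) (S : Subset n) → Decidable (HasFamily G S)
hasFamily? G S k = search-vec search-subgraph k (λ Ts → map′
  (λ (a , b) → record { steiner = a ; independent = b })
  (λ r → let open CompletelyIndependent r in steiner , independent)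
  (Fin.all? (λ p → isSteinerTree? G S (lookup Ts p)) ×-dec
   Fin.all? (λ p → Fin.all? λ q → (p Fin.<? q) →-dec
     independent? S (lookup Ts p) (lookup Ts q))))

------------------------------------------------------------------------
-- The maximum

greatestUpTo : {P : ℕ → Set} → Decidable P → ℕ → ℕ
greatestUpTo P? zero    = zero
greatestUpTo P? (suc b) with P? (suc b)
... | yes _ = suc b
... | no  _ = greatestUpTo P? b

-- Searching up to n * n loses nothing when ∣ S ∣ ≥ 2, since the trees are
-- edge-disjoint and each has an edge: see `κ*-isMaximum`.
κ* : SimpleGraph n → Subset n → ℕ
κ* {n} G S = greatestUpTo (hasFamily? G S) (n * n)

private
  greatest-holds : {P : ℕ → Set} (P? : Decidable P) → P 0 → ∀ b → P (greatestUpTo P? b)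
  greatest-holds P? p₀ zero = p₀
  greatest-holds P? p₀ (suc b) with P? (suc b)
  ... | yes p = p
  ... | no  _ = greatest-holds P? p₀ b

  greatest-upper : {P : ℕ → Set} (P? : Decidable P) → ∀ b j → j ≤ b → P j → j ≤ greatestUpTo P? b
  greatest-upper P? zero    j j≤b p = j≤b
  greatest-upper P? (suc b) j j≤b p with P? (suc b)
  ... | yes _ = j≤b
  ... | no ¬p = greatest-upper P? b j
    (ℕ.≤-pred (ℕ.≤∧≢⇒< j≤b (λ { refl → ¬p p }))) p

  one-member : (S : Subset n) → 1 ≤ ∣ S ∣ → Nonempty S
  one-member (inside  ∷ S) _ = zero , here
  one-member (outside ∷ S) h = let (x , x∈) = one-member S h in suc x , there x∈

  two-members : (S : Subset n) → 2 ≤ ∣ S ∣ → ∃[ x ] ∃[ y ] (x ∈ S × y ∈ S × x ≢ y)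
  two-members (inside  ∷ S) (s≤s h) =
    let (x , x∈) = one-member S h in zero , suc x , here , there x∈ , λ ()
  two-members (outside ∷ S) h = let (x , y , x∈ , y∈ , x≢y) = two-members S h in
    suc x , suc y , there x∈ , there y∈ , x≢y ∘ Fin.suc-injective

  path-edge : {T : Subgraph n} {x y : Fin n} {vs : List (Fin n)} → x ≢ y →
              IsPath T x y vs → ∃[ u ] ∃[ v ] Edge T u v
  path-edge {vs = []}         _   p with IsPath.starts p
  ... | ()
  path-edge {vs = a ∷ []}     x≢y p with IsPath.starts p | IsPath.ends p
  ... | refl | refl = contradiction refl x≢y
  path-edge {vs = a ∷ b ∷ vs} _   p with IsPath.linked p
  ... | e ∷ _ = a , b , e

  family-bound : (G : SimpleGraph n) (S : Subset n) → 2 ≤ ∣ S ∣ →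
                 ∀ k → HasFamily G S k → k ≤ n * n
  family-bound {n} G S h k (Ts , ci) with two-members S h
  ... | x , y , x∈ , y∈ , x≢y = Fin.injective⇒≤ {f = code} (λ {p} {q} → code-injective p q)
    where
    open CompletelyIndependent ci

    an-edge : ∀ p → ∃[ u ] ∃[ v ] Edge (lookup Ts p) u v
    an-edge p = let open IsSteinerTree (steiner p) in
      path-edge x≢y (proj₂ (proj₁ (proj₂ isTree) x y (spans x∈) (spans y∈)))

    code : Fin k → Fin (n * n)
    code p = let (u , v , _) = an-edge p in combine u v

    clash : ∀ p q → p Fin.< q → code p ≢ code q
    clash p q p<q eq with an-edge p | an-edge q
    ... | u , v , e | u′ , v′ , e′ with Fin.combine-injective u v u′ v′ eq
    ... | refl , refl = Independent.edges (independent p q p<q) u v (e , e′)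

    code-injective : ∀ p q → code p ≡ code q → p ≡ q
    code-injective p q eq = decidable-stable (p Fin.≟ q) λ p≢q →
      case-tri p≢q (Fin.<-cmp p q)
      where
      case-tri : p ≢ q → Tri (p Fin.< q) (p ≡ q) (q Fin.< p) → ⊥
      case-tri _   (tri< l _ _) = clash p q l eq
      case-tri p≢q (tri≈ _ e _) = p≢q e
      case-tri _   (tri> _ _ g) = clash q p g (sym eq)

κ*-isMaximum : (G : SimpleGraph n) (S : Subset n) → 2 ≤ ∣ S ∣ →
               IsMaximum (HasFamily G S) (κ* G S)
κ*-isMaximum {n} G S h =
  greatest-holds (hasFamily? G S) ([] , record { steiner = λ () ; independent = λ () }) (n * n) ,
  λ j f → greatest-upper (hasFamily? G S) (n * n) j (family-bound G S h j f) f

------------------------------------------------------------------------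
-- Complete bipartite graphs

-- The vertices of K m₁ m₂ are Fin (m₁ + m₂), with xⱼ the first m₁ and yⱼ
-- the last m₂ of them.
inX : ∀ m₁ m₂ → Fin (m₁ + m₂) → Bool
inX m₁ m₂ v = is-just (isInj₁ (splitAt m₁ {m₂} v))

K : ∀ m₁ m₂ → SimpleGraph (m₁ + m₂)
K m₁ m₂ = record
  { Adj        = λ u v → inX m₁ m₂ u ≢ inX m₁ m₂ v
  ; adj?       = λ u v → ¬? (inX m₁ m₂ u ≟ᵇ inX m₁ m₂ v)
  ; adj-sym    = λ u≢v → u≢v ∘ sym
  ; adj-irrefl = λ u≢u → u≢u refl
  }

initial : ∀ m → ℕ → Subset m
initial m j = tabulate (λ v → does (toℕ v <? j))

-- {x₁, …, xᵢ, y₁, …, yₛ₋ᵢ}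
Sᵢ : ∀ m₁ m₂ (s i : ℕ) → Subset (m₁ + m₂)
Sᵢ m₁ m₂ s i = initial m₁ i ++ initial m₂ (s ∸ i)

{-# OPTIONS --safe #-}
module Submission where

-- Write m₁ = i + a, m₂ = j + b and s = i + j; the hypotheses say a = b + c with
-- i + c ≤ j.  The tree p has centres X_p^0, X_p^1 in X and Y_p^0, Y_p^1 in Y, and
-- its vertices are these and S.  It is rooted at Y_p^0, and the parent of x is
-- Y_p^{τ x}, that of y is X_p^{σ y}, for maps σ, τ that do not depend on p.
-- Distinct trees have disjoint sets of centres, and only centres have children,
-- so two trees p, q can share an edge xy only if x, y ∈ S, x = X_q^{σ y} and
-- y = Y_p^{τ x} (or with p and q exchanged).  Number each side from 0.  For σ the
-- parity, τ the opposite parity on S and 0 elsewhere, and X_p^α, Y_p^β of parities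
-- α, β when they lie in S, this is impossible.  The first b trees use one spare
-- vertex on each side (X_p^0 = X_p^1, Y_p^0 = Y_p^1), the next c a spare vertex of X
-- and two vertices of S in Y, and the others two vertices of S on each side; there
-- is room for b + ⌊(i + c)/2⌋ trees.  With only the first a trees all X_p^α are
-- spare, and a single vertex Y_p^0 = Y_p^1 of S suffices.

open import Defs
open import Data.Bool using (Bool; true; false; not; _∧_; if_then_else_)
import Data.Bool.Properties as Bool
open import Data.Fin using (Fin; toℕ; fromℕ<; splitAt; join)
import Data.Fin as Fin
import Data.Fin.Properties as Fin
open import Data.Fin.Subset using (Subset; _∈_; _∉_; _⊆_; _-_; ∣_∣; ⁅_⁆)
open import Data.Fin.Subset.Properties using (⊆-antisym; x∈p∩q⁺; x∈p∩q⁻; p⊆q⇒∣p∣≤∣q∣;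
  x∈p⇒∣p-x∣<∣p∣; x∈p∧x≢y⇒x∈p-y; ∣⁅x⁆∣≡1; x∈⁅y⁆⇒x≡y; _∈?_)
open import Data.List using (List; []; _∷_; last)
open import Data.List.Membership.Propositional using () renaming (_∈_ to _∈ₗ_)
import Data.List.Membership.DecPropositional as DecMembership
open import Data.List.Relation.Unary.All as All using ([]; _∷_)
open import Data.List.Relation.Unary.All.Properties using (¬Any⇒All¬)
open import Data.List.Relation.Unary.AllPairs using ([]; _∷_)
open import Data.List.Relation.Unary.Any using (here; there)
open import Data.List.Relation.Unary.Linked using ([-]; _∷_)
open import Data.Maybe using (just)
open import Data.Maybe.Properties using (just-injective)
open import Data.Nat using (ℕ; zero; suc; _+_; _*_; _∸_; _/_; _≤_; _<_; _⊔_; _⊓_; z≤n; s≤s;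
  _≟_; _<?_)
import Data.Nat.Properties as ℕ
open import Data.Nat.DivMod using (m/n*n≤m)
open import Data.Nat.Solver using (module +-*-Solver)
open +-*-Solver using (solve; _:=_; _:+_; _:*_; con)
open import Data.Product using (_×_; _,_; ∃; ∃-syntax; proj₁; proj₂)
open import Data.Sum using (_⊎_; inj₁; inj₂; [_,_]′; swap) renaming (map to map⊎)
open import Data.Sum.Properties using (inj₁-injective; inj₂-injective)
open import Data.Vec using (lookup; tabulate)
open import Data.Vec.Properties using (lookup∘tabulate; lookup-splitAt; []=⇒lookup; lookup⇒[]=)
open import Function using (_∘_)
open import Relation.Binary.Construct.Closure.ReflexiveTransitive using (Star; ε; _◅_; _◅◅_; reverse)
open import Relation.Binary.PropositionalEquality using (_≡_; _≢_; refl; sym; trans; cong; subst)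
open import Relation.Nullary using (¬_; Dec; yes; no; does; contradiction)
open import Relation.Nullary.Decidable using (_×-dec_; _⊎-dec_; ¬?; map′; dec-true; dec-false)
open import Relation.Unary using (Decidable)

private
  variable
    n k : ℕ

-- Subsets cut out by decidable predicates

dec-true⁻ : {A : Set} (a? : Dec A) → does a? ≡ true → A
dec-true⁻ (yes a) _ = a

⟪_⟫ : {P : Fin n → Set} → Decidable P → Subset n
⟪ P? ⟫ = tabulate (does ∘ P?)

module _ {P : Fin n → Set} (P? : Decidable P) where

  ∈⟪⟫⁺ : ∀ {v} → P v → v ∈ ⟪ P? ⟫
  ∈⟪⟫⁺ {v} p = lookup⇒[]= v _ (trans (lookup∘tabulate _ v) (dec-true (P? v) p))

  ∈⟪⟫⁻ : ∀ {v} → v ∈ ⟪ P? ⟫ → P v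
  ∈⟪⟫⁻ {v} v∈ = dec-true⁻ (P? v) (trans (sym (lookup∘tabulate _ v)) ([]=⇒lookup v∈))

two-members⇒2≤∣p∣ : {p : Subset n} {x y : Fin n} → x ∈ p → y ∈ p → x ≢ y → 2 ≤ ∣ p ∣
two-members⇒2≤∣p∣ {p = p} {x} {y} x∈p y∈p x≢y = begin
  2                   ≡⟨ cong suc (∣⁅x⁆∣≡1 y) ⟨
  suc ∣ ⁅ y ⁆ ∣       ≤⟨ s≤s (p⊆q⇒∣p∣≤∣q∣ ⁅y⁆⊆) ⟩
  suc ∣ p - x ∣       ≤⟨ x∈p⇒∣p-x∣<∣p∣ x∈p ⟩
  ∣ p ∣               ∎
  where
  open ℕ.≤-Reasoning
  ⁅y⁆⊆ : ⁅ y ⁆ ⊆ p - x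
  ⁅y⁆⊆ z∈ rewrite x∈⁅y⁆⇒x≡y y z∈ = x∈p∧x≢y⇒x∈p-y y∈p (x≢y ∘ sym)

-- Paths

last-∈ : {v : Fin n} (vs : List (Fin n)) → last vs ≡ just v → v ∈ₗ vs
last-∈ (x ∷ [])     refl = here refl
last-∈ (x ∷ y ∷ vs) eq   = there (last-∈ (y ∷ vs) eq)

module _ {T : Subgraph n} where

  path-tail : ∀ {a b c v vs} → IsPath T a v (b ∷ c ∷ vs) → IsPath T c v (c ∷ vs)
  path-tail record { ends = e ; inside-T = _ ∷ i ; linked = _ ∷ l ; unique = _ ∷ u } =
    record { starts = refl ; ends = e ; inside-T = i ; linked = l ; unique = u }

  path-head : ∀ {a b v vs} → IsPath T a v (b ∷ vs) → b ≡ a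
  path-head π = just-injective (IsPath.starts π)

  path-step : ∀ {a b c v vs} → IsPath T a v (b ∷ c ∷ vs) → Edge T b c
  path-step record { linked = e ∷ _ } = e

  path-unique : ∀ {a b v w vs} → IsPath T a v (b ∷ vs) → w ∈ₗ vs → b ≢ w
  path-unique record { unique = d ∷ _ } w∈ = All.lookup d w∈

  path-suffix : ∀ {a v u} vs → IsPath T a v vs → u ∈ₗ vs → ∃[ us ] IsPath T u v us
  path-suffix (b ∷ vs) π (here refl) = b ∷ vs , record
    { starts = refl ; ends = ends ; inside-T = inside-T ; linked = linked ; unique = unique }
    where open IsPath π
  path-suffix (b ∷ c ∷ vs) π (there u∈) = path-suffix (c ∷ vs) (path-tail π) u∈

  -- Loop erasure: if the new first vertex already lies on the path built so far, the suffix
  -- starting there replaces that path.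
  walk⇒path : ∀ {u v} → (∀ {a b} → Edge T a b → a ∈ verts T) → v ∈ verts T →
              Star (Edge T) u v → ∃[ vs ] IsPath T u v vs
  walk⇒path {v = v} _ v∈ ε = v ∷ [] , record
    { starts = refl ; ends = refl ; inside-T = v∈ ∷ [] ; linked = [-] ; unique = [] ∷ [] }
  walk⇒path {u = u} edge⇒∈ v∈ (e ◅ walk) with walk⇒path edge⇒∈ v∈ walk
  ... | b ∷ vs , π with DecMembership._∈?_ Fin._≟_ u (b ∷ vs) | path-head π
  ... | yes u∈ | _    = path-suffix (b ∷ vs) π u∈
  ... | no  u∉ | refl = u ∷ b ∷ vs , record
    { starts = refl ; ends = ends ; inside-T = edge⇒∈ e ∷ inside-T
    ; linked = e ∷ linked ; unique = ¬Any⇒All¬ _ u∉ ∷ unique }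
    where open IsPath π

TwoNeighbours : Subgraph n → Fin n → Set
TwoNeighbours T v = ∃[ a ] ∃[ b ] (a ≢ b × Edge T v a × Edge T v b)

-- The predecessor and the successor of an internal vertex are two neighbours, distinct because a
-- path repeats no vertex.
internal⇒twoNeighbours : {T : Subgraph n} → (∀ {a b} → Edge T a b → Edge T b a) →
  ∀ {u v w} vs → IsPath T u v vs → Internal u v vs w → TwoNeighbours T w
internal⇒twoNeighbours esym (a ∷ vs) π (here refl , w≢u , _) =
  contradiction (path-head π) w≢u
internal⇒twoNeighbours esym (a ∷ b ∷ []) π (there (here refl) , _ , w≢v) =
  contradiction (just-injective (IsPath.ends π)) w≢v
internal⇒twoNeighbours esym (a ∷ b ∷ c ∷ vs) π (there (here refl) , _) =
  a , c , path-unique π (there (here refl)) , esym (path-step π) , path-step (path-tail π)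
internal⇒twoNeighbours esym (a ∷ b ∷ c ∷ vs) π (there (there w∈) , _ , w≢v) =
  internal⇒twoNeighbours esym (b ∷ c ∷ vs) (path-tail π)
    (there w∈ , path-unique (path-tail π) w∈ ∘ sym , w≢v)

-- Trees from parent functions

module RootedTree
  {P : Fin n → Set} (P? : Decidable P)
  (root : Fin n) (parent : Fin n → Fin n) (rank : Fin n → ℕ)
  (P-root : P root) (P-parent : ∀ v → P (parent v))
  (rank-parent : ∀ v → v ≢ root → rank (parent v) < rank v)
  where

  _◁_ : Fin n → Fin n → Set
  u ◁ v = P u × u ≢ root × parent u ≡ v

  _◁?_ : ∀ u v → Dec (u ◁ v)
  u ◁? v = P? u ×-dec ¬? (u Fin.≟ root) ×-dec (parent u Fin.≟ v)

  link? : ∀ u v → Dec (u ◁ v ⊎ v ◁ u)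
  link? u v = (u ◁? v) ⊎-dec (v ◁? u)

  tree : Subgraph n
  tree = subgraph ⟪ P? ⟫ (tabulate (λ u → ⟪ link? u ⟫))

  edge⁺ : ∀ {u v} → u ◁ v ⊎ v ◁ u → Edge tree u v
  edge⁺ {u} {v} l = subst (v ∈_) (sym (lookup∘tabulate _ u)) (∈⟪⟫⁺ (link? u) l)

  edge⁻ : ∀ {u v} → Edge tree u v → u ◁ v ⊎ v ◁ u
  edge⁻ {u} {v} e = ∈⟪⟫⁻ (link? u) (subst (v ∈_) (lookup∘tabulate _ u) e)

  edge-sym′ : ∀ {u v} → Edge tree u v → Edge tree v u
  edge-sym′ = edge⁺ ∘ swap ∘ edge⁻

  edge⇒∈ : ∀ {u v} → Edge tree u v → u ∈ verts tree
  edge⇒∈ e with edge⁻ e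
  ... | inj₁ (p , _)            = ∈⟪⟫⁺ P? p
  ... | inj₂ (_ , _ , refl)     = ∈⟪⟫⁺ P? (P-parent _)

  ◁⇒rank< : ∀ {u v} → u ◁ v → rank v < rank u
  ◁⇒rank< (_ , u≢root , refl) = rank-parent _ u≢root

  -- `r` is fuel: it bounds the rank, which drops at each step to a parent.
  walk-to-root : ∀ r v → rank v < r → P v → Star (Edge tree) v root
  walk-to-root (suc r) v v<r p with v Fin.≟ root
  ... | yes refl   = ε
  ... | no  v≢root = edge⁺ (inj₁ (p , v≢root , refl)) ◅
    walk-to-root r (parent v) (ℕ.<-≤-trans (rank-parent v v≢root) (ℕ.≤-pred v<r)) (P-parent v)

  connected : Connected tree
  connected u v u∈ v∈ = walk⇒path edge⇒∈ v∈ (to-root u∈ ◅◅ reverse edge-sym′ (to-root v∈))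
    where
    to-root : ∀ {w} → w ∈ verts tree → Star (Edge tree) w root
    to-root {w} w∈ = walk-to-root (suc (rank w)) w ℕ.≤-refl (∈⟪⟫⁻ P? w∈)

  -- After the descent from `a` to `b`, going up from `b` would lead back to its only parent `a`,
  -- which the path has already visited.
  no-turn : ∀ {x a b c v vs} → b ◁ a → IsPath tree x v (a ∷ b ∷ c ∷ vs) → c ◁ b
  no-turn (_ , _ , refl) π with edge⁻ (path-step (path-tail π))
  ... | inj₁ (_ , _ , refl) = contradiction refl (path-unique π (there (here refl)))
  ... | inj₂ c◁b            = c◁b

  -- By `no-turn` all later steps descend as well, and each of them raises the rank.
  descending : ∀ {x a b v} vs → b ◁ a → IsPath tree x v (a ∷ b ∷ vs) → rank a < rank v
  descending [] b◁a π with IsPath.ends π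
  ... | refl = ◁⇒rank< b◁a
  descending (c ∷ vs) b◁a π =
    ℕ.<-trans (◁⇒rank< b◁a) (descending vs (no-turn b◁a π) (path-tail π))

  -- If the last step descends, it starts at `parent v`. If it ascends, so do all steps before it,
  -- since an ascent never follows a descent.
  ascending-or-parent : ∀ {x a b v} vs → IsPath tree x v (a ∷ b ∷ vs) →
                        rank v < rank a ⊎ parent v ∈ₗ (a ∷ b ∷ vs)
  ascending-or-parent [] π with IsPath.ends π | edge⁻ (path-step π)
  ... | refl | inj₁ a◁b            = inj₁ (◁⇒rank< a◁b)
  ... | refl | inj₂ (_ , _ , refl) = inj₂ (here refl)
  ascending-or-parent (c ∷ vs) π with ascending-or-parent vs (path-tail π) | edge⁻ (path-step π)
  ... | inj₂ v∈  | _        = inj₂ (there v∈)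
  ... | inj₁ v<b | inj₁ a◁b = inj₁ (ℕ.<-trans v<b (◁⇒rank< a◁b))
  ... | inj₁ v<b | inj₂ b◁a =
    contradiction (descending vs (no-turn b◁a π) (path-tail π)) (ℕ.<-asym v<b)

  -- A path climbs towards the root and then descends, and never turns again;
  -- the closing edge of a cycle contradicts this.
  acyclic : ¬ HasCycle tree
  acyclic (u , v , a ∷ b ∷ [] , π , s≤s (s≤s ()) , _)
  acyclic (u , v , a ∷ b ∷ c ∷ vs , π , _ , e) with path-head π | edge⁻ e | edge⁻ (path-step π)
  ... | refl | inj₂ (_ , _ , refl) | inj₁ (_ , _ , refl) =
    path-unique (path-tail π) (last-∈ (c ∷ vs) (IsPath.ends π)) refl
  ... | refl | inj₂ a◁v | inj₂ b◁a =
    ℕ.<-asym (◁⇒rank< a◁v) (descending (c ∷ vs) b◁a π)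
  ... | refl | inj₁ v◁a | inj₂ b◁a with ascending-or-parent vs (path-tail π) | v◁a
  ...   | inj₂ a∈  | _ , _ , refl = path-unique π a∈ refl
  ...   | inj₁ v<b | _ = ℕ.<-asym v<b (descending vs (no-turn b◁a π) (path-tail π))
  acyclic (u , v , a ∷ b ∷ c ∷ vs , π , _ , e) | refl | inj₁ v◁a | inj₁ a◁b
    with ascending-or-parent vs (path-tail π) | v◁a
  ...   | inj₂ a∈  | _ , _ , refl = path-unique π a∈ refl
  ...   | inj₁ v<b | _ = ℕ.<-asym v<b (ℕ.<-trans (◁⇒rank< a◁b) (◁⇒rank< v◁a))

  isTree : IsTree tree
  isTree = (root , ∈⟪⟫⁺ P? P-root) , connected , acyclic

  -- At most one neighbour of `v` is its parent without being a child, so two distinct neighbours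
  -- include a child.
  twoNeighbours⇒child : ∀ {v} → TwoNeighbours tree v → ∃[ u ] u ◁ v
  twoNeighbours⇒child (a , b , a≢b , e , e′) with edge⁻ e | edge⁻ e′
  ... | inj₂ a◁v            | _                   = a , a◁v
  ... | inj₁ _              | inj₂ b◁v            = b , b◁v
  ... | inj₁ (_ , _ , refl) | inj₁ (_ , _ , refl) = contradiction refl a≢b

-- A vertex of S with two neighbours in a tree is one of its centres, so
-- disjointness of the sets of centres gives disjointness of the paths.
module Family
  (G : SimpleGraph n) (S : Subset n)
  (Centre : Fin k → Fin n → Set) (centre? : ∀ p → Decidable (Centre p))
  (root : Fin k → Fin n) (parent : Fin k → Fin n → Fin n) (rank : Fin k → Fin n → ℕ)
  (centre-root : ∀ p → Centre p (root p))
  (centre-parent : ∀ p v → Centre p (parent p v))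
  (rank-parent : ∀ p v → v ≢ root p → rank p (parent p v) < rank p v)
  (adj-parent : ∀ p v → SimpleGraph.Adj G v (parent p v))
  (centre-unique : ∀ {p q} v → Centre p v → Centre q v → p ≡ q)
  (no-swap : ∀ p q u v → u ∈ S → v ∈ S → parent p u ≡ v → ¬ (parent q v ≡ u))
  where

  private
    Vertex : Fin k → Fin n → Set
    Vertex p v = v ∈ S ⊎ Centre p v

    vertex? : ∀ p → Decidable (Vertex p)
    vertex? p v = (v ∈? S) ⊎-dec centre? p v

    module Tree p = RootedTree (vertex? p) (root p) (parent p) (rank p)
      (inj₂ (centre-root p)) (inj₂ ∘ centre-parent p) (rank-parent p)

  Child : Fin k → Fin n → Fin n → Set
  Child = Tree._◁_

  -- This gives every centre outside `S` degree at least two, so that all leaves lie in `S`. It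
  -- comes after the other hypotheses because `Child` is built from them.
  module _ (spare-twoNeighbours : ∀ p v → Centre p v → v ∉ S →
              ∃[ a ] ∃[ b ] (a ≢ b × (Child p v a ⊎ Child p a v) × (Child p v b ⊎ Child p b v)))
    where

    private
      steinerTree : ∀ p → IsSteinerTree G S (Tree.tree p)
      steinerTree p = record
        { isSubgraph = record
          { edge⇒adj = adj ; edge-sym = λ _ _ → edge-sym′ ; edge⇒verts = λ _ _ → edge⇒∈ }
        ; isTree = isTree
        ; spans  = ∈⟪⟫⁺ (vertex? p) ∘ inj₁
        ; leaves = leaves
        }
        where
        open Tree p
        adj : ∀ u v → Edge tree u v → SimpleGraph.Adj G u v
        adj u v e with edge⁻ e
        ... | inj₁ (_ , _ , refl) = adj-parent p u
        ... | inj₂ (_ , _ , refl) = SimpleGraph.adj-sym G (adj-parent p v)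

        leaves : ∀ v → Leaf tree v → v ∈ S
        leaves v (v∈ , deg≡1) with v ∈? S | ∈⟪⟫⁻ (vertex? p) v∈
        ... | yes v∈S | _       = v∈S
        ... | no  v∉S | inj₁ v∈S = v∈S
        ... | no  v∉S | inj₂ c with spare-twoNeighbours p v c v∉S
        ... | _ , _ , a≢b , l , l′ = contradiction deg≡1
          (ℕ.>⇒≢ (two-members⇒2≤∣p∣ (edge⁺ l) (edge⁺ l′) a≢b))

      module _ {p q : Fin k} (p≢q : p ≢ q) where

        common⇒∈S : ∀ {v} → Vertex p v → Vertex q v → v ∈ S
        common⇒∈S (inj₁ v∈S) _          = v∈S
        common⇒∈S _          (inj₁ v∈S) = v∈S
        common⇒∈S (inj₂ c)   (inj₂ c′)  = contradiction (centre-unique _ c c′) p≢q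

        -- The common parent would be a centre of both trees.
        ◁-parallel : ∀ {u v} → Child p u v → ¬ Child q u v
        ◁-parallel (_ , _ , refl) (_ , _ , eq) =
          p≢q (centre-unique _ (centre-parent p _) (subst (Centre q) eq (centre-parent q _)))

        -- Each end is a centre of one tree and a vertex of the other, hence lies in `S`, where
        -- `no-swap` applies.
        ◁-opposite : ∀ {u v} → Child p u v → ¬ Child q v u
        ◁-opposite {u} {v} (u∈p , _ , eq) (v∈q , _ , eq′) = no-swap p q u v
          (common⇒∈S u∈p (inj₂ (subst (Centre q) eq′ (centre-parent q _))))
          (common⇒∈S (inj₂ (subst (Centre p) eq (centre-parent p _))) v∈q) eq eq′

        edgeDisjoint : EdgeDisjoint (Tree.tree p) (Tree.tree q)
        edgeDisjoint u v (e , e′) with Tree.edge⁻ p e | Tree.edge⁻ q e′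
        ... | inj₁ l | inj₁ l′ = ◁-parallel l l′
        ... | inj₁ l | inj₂ l′ = ◁-opposite l l′
        ... | inj₂ l | inj₁ l′ = ◁-opposite l l′
        ... | inj₂ l | inj₂ l′ = ◁-parallel l l′

        internal⇒centre : ∀ r {u v w vs} → IsPath (Tree.tree r) u v vs → Internal u v vs w → Centre r w
        internal⇒centre r π i with Tree.twoNeighbours⇒child r
          (internal⇒twoNeighbours (Tree.edge-sym′ r) _ π i)
        ... | _ , _ , _ , refl = centre-parent r _

        independent : Independent S (Tree.tree p) (Tree.tree q)
        independent = record
          { edges  = edgeDisjoint
          ; verts∩ = ⊆-antisym
            (λ v∈ → let (v∈p , v∈q) = x∈p∩q⁻ _ _ v∈ in
              common⇒∈S (∈⟪⟫⁻ (vertex? p) v∈p) (∈⟪⟫⁻ (vertex? q) v∈q))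
            (λ v∈S → x∈p∩q⁺ (∈⟪⟫⁺ (vertex? p) (inj₁ v∈S) , ∈⟪⟫⁺ (vertex? q) (inj₁ v∈S)))
          ; paths  = λ _ _ _ _ _ _ _ π π′ w (i , i′) →
              p≢q (centre-unique w (internal⇒centre p π i) (internal⇒centre q π′ i′))
          }

    hasFamily : HasFamily G S k
    hasFamily = tabulate Tree.tree , record
      { steiner     = λ p → subst (IsSteinerTree G S) (sym (lookup∘tabulate _ p)) (steinerTree p)
      ; independent = λ p q p<q →
          subst (λ T → Independent S T _) (sym (lookup∘tabulate _ p))
            (subst (Independent S _) (sym (lookup∘tabulate _ q)) (independent (Fin.<⇒≢ p<q)))
      }

-- Parity

odd : ℕ → Bool
odd zero    = false
odd (suc m) = not (odd m)

bit : Bool → ℕ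
bit false = 0
bit true  = 1

odd-bit+*2 : ∀ α r → odd (bit α + r * 2) ≡ α
odd-bit+*2 false zero    = refl
odd-bit+*2 true  zero    = refl
odd-bit+*2 false (suc r) = trans (Bool.not-involutive _) (odd-bit+*2 false r)
odd-bit+*2 true  (suc r) = trans (Bool.not-involutive _) (odd-bit+*2 true r)

-- Comparing parities shows that the bits agree. The pairs 2r, 2r + 1 that serve as centres in `S`
-- are therefore disjoint for distinct r.
bit+*2-injective : ∀ α β r t → bit α + r * 2 ≡ bit β + t * 2 → r ≡ t
bit+*2-injective α β r t eq
  with refl ← trans (sym (odd-bit+*2 α r)) (trans (cong odd eq) (odd-bit+*2 β t)) =
  ℕ.*-cancelʳ-≡ r t 2 (ℕ.+-cancelˡ-≡ (bit α) _ _ eq)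

bit+*2<suc*2 : ∀ α r → bit α + r * 2 < suc r * 2
bit+*2<suc*2 false r = s≤s (ℕ.n≤1+n _)
bit+*2<suc*2 true  r = ℕ.≤-refl

-- On one side of the bipartition, with i vertices in S and a spare ones, the
-- first a trees have a spare vertex as centre and the others have centres in S.
module Slot
  (i a k : ℕ) (f : ℕ → Bool → ℕ)
  (f-small : ∀ p α → a ≤ p → p < k → f (p ∸ a) α < i)
  (f-injective : ∀ {r t} α β → f r α ≡ f t β → r ≡ t)
  where

  slot : ℕ → Bool → ℕ
  slot p α with p <? a
  ... | yes _ = i + p
  ... | no  _ = f (p ∸ a) α

  slot-spare : ∀ {p} α → p < a → slot p α ≡ i + p
  slot-spare {p} α p<a with p <? a
  ... | yes _   = refl
  ... | no  p≮a = contradiction p<a p≮a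

  slot-inner : ∀ {p} α → a ≤ p → slot p α ≡ f (p ∸ a) α
  slot-inner {p} α a≤p with p <? a
  ... | yes p<a = contradiction a≤p (ℕ.<⇒≱ p<a)
  ... | no  _   = refl

  slot<i⇒a≤p : ∀ {p} α → slot p α < i → a ≤ p
  slot<i⇒a≤p {p} α slot<i with p <? a
  ... | yes _   = contradiction slot<i (ℕ.m+n≮m i p)
  ... | no  p≮a = ℕ.≮⇒≥ p≮a

  slot≮i⇒p<a : ∀ {p} α → p < k → ¬ (slot p α < i) → p < a
  slot≮i⇒p<a {p} α p<k slot≮i with p <? a
  ... | yes p<a = p<a
  ... | no  p≮a = contradiction (f-small p α (ℕ.≮⇒≥ p≮a) p<k) slot≮i

  slot-bound : ∀ {p} α → p < k → slot p α < i + a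
  slot-bound {p} α p<k with p <? a
  ... | yes p<a = ℕ.+-monoʳ-< i p<a
  ... | no  p≮a = ℕ.<-≤-trans (f-small p α (ℕ.≮⇒≥ p≮a) p<k) (ℕ.m≤m+n i a)

  -- Spare centres sit at positions from `i` on and inner ones below `i`, so a spare and an inner
  -- centre never coincide.
  slot-unique : ∀ {p q} α β → p < k → q < k → slot p α ≡ slot q β → p ≡ q
  slot-unique {p} {q} α β p<k q<k eq with p <? a | q <? a
  ... | yes _   | yes _   = ℕ.+-cancelˡ-≡ i p q eq
  ... | yes _   | no  q≮a = contradiction
    (subst (_< i) (sym eq) (f-small q β (ℕ.≮⇒≥ q≮a) q<k)) (ℕ.m+n≮m i p)
  ... | no  p≮a | yes _   = contradiction
    (subst (_< i) eq (f-small p α (ℕ.≮⇒≥ p≮a) p<k)) (ℕ.m+n≮m i q)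
  ... | no  p≮a | no  q≮a = ℕ.∸-cancelʳ-≡ (ℕ.≮⇒≥ p≮a) (ℕ.≮⇒≥ q≮a) (f-injective α β eq)

-- The trees in the complete bipartite graph

module CompleteBipartite
  (i j a b k : ℕ) (0<i : 0 < i) (0<j : 0 < j) (b≤a : b ≤ a) (1<j : b < a → 1 < j)
  (x-small : ∀ p α → a ≤ p → p < k → bit α + (p ∸ a) * 2 < i)
  -- `g t` gives the centres in Y of tree `b + t`. It stays a parameter because one bound uses a
  -- single vertex for both centres and the other a pair.
  (g : ℕ → Bool → ℕ)
  (g-small : ∀ p β → b ≤ p → p < k → g (p ∸ b) β < j)
  (g-injective : ∀ {r t} α β → g r α ≡ g t β → r ≡ t)
  (g-true : ∀ t → g t true ≡ g t false ⊎ odd (g t true) ≡ true)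
  -- A shared edge has an end in `S` that is a centre in X, and such centres exist only for trees
  -- numbered from `a` on.
  (g-odd : a < k → ∀ t β → odd (g t β) ≡ β)
  where

  private
    module X = Slot i a k (λ r α → bit α + r * 2) x-small (λ α β → bit+*2-injective α β _ _)
    module Y = Slot j b k g g-small g-injective

    -- The construction is carried out on the disjoint union of the two sides and transported to the
    -- vertices of `K` by `dec` and `enc`.
    V : Set
    V = Fin (i + a) ⊎ Fin (j + b)

    S : Subset ((i + a) + (j + b))
    S = Sᵢ (i + a) (j + b) (i + j) i

    dec : Fin ((i + a) + (j + b)) → V
    dec = splitAt (i + a)

    enc : V → Fin ((i + a) + (j + b))
    enc = join (i + a) (j + b)

    dec-enc : ∀ w → dec (enc w) ≡ w
    dec-enc = Fin.splitAt-join (i + a) (j + b)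

    enc-dec : ∀ v → enc (dec v) ≡ v
    enc-dec = Fin.join-splitAt (i + a) (j + b)

    InS : V → Set
    InS (inj₁ x) = toℕ x < i
    InS (inj₂ y) = toℕ y < j

    lookup-S : ∀ w → lookup S (enc w) ≡ [ (λ x → does (toℕ x <? i)) , (λ y → does (toℕ y <? j)) ]′ w
    lookup-S w = trans
      (lookup-splitAt (i + a) (initial (i + a) i) (initial (j + b) ((i + j) ∸ i)) (enc w))
      (trans (cong [ _ , _ ]′ (dec-enc w)) (entry w))
      where
      entry : ∀ w → [ lookup (initial (i + a) i) , lookup (initial (j + b) ((i + j) ∸ i)) ]′ w
                    ≡ [ (λ x → does (toℕ x <? i)) , (λ y → does (toℕ y <? j)) ]′ w
      entry (inj₁ x) = lookup∘tabulate _ x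
      entry (inj₂ y) rewrite ℕ.m+n∸m≡n i j = lookup∘tabulate _ y

    ∈S⁺ : ∀ w → InS w → enc w ∈ S
    ∈S⁺ w w∈ = lookup⇒[]= (enc w) S (trans (lookup-S w) (entry w w∈))
      where
      entry : ∀ w → InS w → [ (λ x → does (toℕ x <? i)) , (λ y → does (toℕ y <? j)) ]′ w ≡ true
      entry (inj₁ x) x<i = dec-true (toℕ x <? i) x<i
      entry (inj₂ y) y<j = dec-true (toℕ y <? j) y<j

    ∈S⁻ : ∀ w → enc w ∈ S → InS w
    ∈S⁻ w w∈ = entry w (trans (sym (lookup-S w)) ([]=⇒lookup w∈))
      where
      entry : ∀ w → [ (λ x → does (toℕ x <? i)) , (λ y → does (toℕ y <? j)) ]′ w ≡ true → InS w
      entry (inj₁ x) = dec-true⁻ (toℕ x <? i)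
      entry (inj₂ y) = dec-true⁻ (toℕ y <? j)

    -- The value `false` of `τ` off `S` attaches spare vertices of X directly to the root.
    σ τ : ℕ → Bool
    σ y = odd y
    τ x = does (x <? i) ∧ not (odd x)

    cx : Fin k → Bool → Fin (i + a)
    cx p α = fromℕ< (X.slot-bound α (Fin.toℕ<n p))

    cy : Fin k → Bool → Fin (j + b)
    cy p β = fromℕ< (Y.slot-bound β (Fin.toℕ<n p))

    toℕ-cx : ∀ p α → toℕ (cx p α) ≡ X.slot (toℕ p) α
    toℕ-cx p α = Fin.toℕ-fromℕ< _

    toℕ-cy : ∀ p β → toℕ (cy p β) ≡ Y.slot (toℕ p) β
    toℕ-cy p β = Fin.toℕ-fromℕ< _

    root : Fin k → V
    root p = inj₂ (cy p false)

    parent : Fin k → V → V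
    parent p (inj₁ x) = inj₂ (cy p (τ (toℕ x)))
    parent p (inj₂ y) = inj₁ (cx p (σ (toℕ y)))

    -- Parents have smaller rank because τ vanishes at X_p^1, while Y_p^1 either is
    -- the root or has σ = 1.
    rank : Fin k → V → ℕ
    rank p (inj₁ x) = if τ (toℕ x) then 3 else 1
    rank p (inj₂ y) = if does (y Fin.≟ cy p false) then 0 else if σ (toℕ y) then 2 else 4

    Centre : Fin k → V → Set
    Centre p (inj₁ x) = ∃[ α ] x ≡ cx p α
    Centre p (inj₂ y) = ∃[ β ] y ≡ cy p β

    any-Bool? : {P : Bool → Set} → (∀ α → Dec (P α)) → Dec (∃ P)
    any-Bool? P? = map′ [ (false ,_) , (true ,_) ]′
      (λ { (false , p) → inj₁ p ; (true , p) → inj₂ p }) (P? false ⊎-dec P? true)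

    centre? : ∀ p → (w : V) → Dec (Centre p w)
    centre? p (inj₁ x) = any-Bool? (λ α → x Fin.≟ cx p α)
    centre? p (inj₂ y) = any-Bool? (λ β → y Fin.≟ cy p β)

    centre-parent : ∀ p w → Centre p (parent p w)
    centre-parent p (inj₁ x) = _ , refl
    centre-parent p (inj₂ y) = _ , refl

    centre-unique : ∀ {p q} w → Centre p w → Centre q w → p ≡ q
    centre-unique {p} {q} (inj₁ x) (α , eq) (β , eq′) = Fin.toℕ-injective
      (X.slot-unique α β (Fin.toℕ<n p) (Fin.toℕ<n q)
        (trans (sym (toℕ-cx p α)) (trans (cong toℕ (trans (sym eq) eq′)) (toℕ-cx q β))))
    centre-unique {p} {q} (inj₂ y) (α , eq) (β , eq′) = Fin.toℕ-injective
      (Y.slot-unique α β (Fin.toℕ<n p) (Fin.toℕ<n q)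
        (trans (sym (toℕ-cy p α)) (trans (cong toℕ (trans (sym eq) eq′)) (toℕ-cy q β))))

    τ-spare : ∀ {x} → ¬ (x < i) → τ x ≡ false
    τ-spare {x} x≮i rewrite dec-false (x <? i) x≮i = refl

    τ-inner : ∀ {x} → x < i → τ x ≡ not (odd x)
    τ-inner {x} x<i rewrite dec-true (x <? i) x<i = refl

    cx-inner-odd : ∀ p α → a ≤ toℕ p → odd (toℕ (cx p α)) ≡ α
    cx-inner-odd p α a≤p = trans (cong odd (trans (toℕ-cx p α) (X.slot-inner α a≤p)))
      (odd-bit+*2 α (toℕ p ∸ a))

    toℕ-cy-inner : ∀ p β → b ≤ toℕ p → toℕ (cy p β) ≡ g (toℕ p ∸ b) β
    toℕ-cy-inner p β b≤p = trans (toℕ-cy p β) (Y.slot-inner β b≤p)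

    cx<i⇒a≤p : ∀ p α → toℕ (cx p α) < i → a ≤ toℕ p
    cx<i⇒a≤p p α = X.slot<i⇒a≤p α ∘ subst (_< i) (toℕ-cx p α)

    cy<j⇒b≤p : ∀ p β → toℕ (cy p β) < j → b ≤ toℕ p
    cy<j⇒b≤p p β = Y.slot<i⇒a≤p β ∘ subst (_< j) (toℕ-cy p β)

    cx≮i⇒p<a : ∀ p α → ¬ (toℕ (cx p α) < i) → toℕ p < a
    cx≮i⇒p<a p α x≮i = X.slot≮i⇒p<a α (Fin.toℕ<n p) (x≮i ∘ subst (_< i) (sym (toℕ-cx p α)))

    cy≮j⇒p<b : ∀ p β → ¬ (toℕ (cy p β) < j) → toℕ p < b
    cy≮j⇒p<b p β y≮j = Y.slot≮i⇒p<a β (Fin.toℕ<n p) (y≮j ∘ subst (_< j) (sym (toℕ-cy p β)))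

    cx-spare : ∀ p α β → toℕ p < a → cx p α ≡ cx p β
    cx-spare p α β p<a = Fin.toℕ-injective (trans (trans (toℕ-cx p α) (X.slot-spare α p<a))
      (sym (trans (toℕ-cx p β) (X.slot-spare β p<a))))

    cy-spare : ∀ p α β → toℕ p < b → cy p α ≡ cy p β
    cy-spare p α β p<b = Fin.toℕ-injective (trans (trans (toℕ-cy p α) (Y.slot-spare α p<b))
      (sym (trans (toℕ-cy p β) (Y.slot-spare β p<b))))

    -- X_p^1 is odd if it lies in `S` and spare otherwise; `τ` vanishes in both cases.
    τ-cx-true : ∀ p → τ (toℕ (cx p true)) ≡ false
    τ-cx-true p with toℕ (cx p true) <? i
    ... | no  x≮i = τ-spare x≮i
    ... | yes x<i = trans (τ-inner x<i) (cong not (cx-inner-odd p true (cx<i⇒a≤p p true x<i)))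

    cy-true : ∀ p → cy p true ≡ cy p false ⊎ σ (toℕ (cy p true)) ≡ true
    cy-true p with ℕ.<-≤-connex (toℕ p) b | g-true (toℕ p ∸ b)
    ... | inj₁ p<b | _          = inj₁ (cy-spare p true false p<b)
    ... | inj₂ b≤p | inj₁ same  = inj₁ (Fin.toℕ-injective
      (trans (toℕ-cy-inner p true b≤p) (trans same (sym (toℕ-cy-inner p false b≤p)))))
    ... | inj₂ b≤p | inj₂ isOdd = inj₂ (trans (cong odd (toℕ-cy-inner p true b≤p)) isOdd)

    rank-root : ∀ p → rank p (root p) ≡ 0
    rank-root p rewrite dec-true (cy p false Fin.≟ cy p false) refl = refl

    rank-cy-true : ∀ p → rank p (inj₂ (cy p true)) ≤ 2
    rank-cy-true p with cy-true p
    ... | inj₁ eq rewrite eq | dec-true (cy p false Fin.≟ cy p false) refl = z≤n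
    ... | inj₂ eq rewrite eq with does (cy p true Fin.≟ cy p false)
    ...   | true  = z≤n
    ...   | false = ℕ.≤-refl

    rank-X : ∀ p x → rank p (inj₁ x) ≤ 3
    rank-X p x with τ (toℕ x)
    ... | true  = ℕ.≤-refl
    ... | false = s≤s z≤n

    -- Below rank 4 of an even y that is not the root lies X_p^0, of rank at most 3; below rank 3
    -- lies Y_p^1, of rank at most 2; below rank 2 lies X_p^1, of rank 1; below rank 1 lies the
    -- root.
    rank-parent : ∀ p w → w ≢ root p → rank p (parent p w) < rank p w
    rank-parent p (inj₁ x) _ with τ (toℕ x)
    ... | true  = s≤s (rank-cy-true p)
    ... | false rewrite rank-root p = s≤s z≤n
    rank-parent p (inj₂ y) y≢root
      rewrite dec-false (y Fin.≟ cy p false) (y≢root ∘ cong inj₂)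
      with σ (toℕ y)
    ... | true rewrite τ-cx-true p = ℕ.≤-refl
    ... | false = s≤s (rank-X p (cx p false))

    -- If xy is an edge of both p and q, with y a centre of p and x a centre of
    -- q, then x = X_q^α and y = Y_p^β with α = σ y = β = τ x = not α.
    no-swap-XY : ∀ p q x y → toℕ x < i → toℕ y < j →
                 cy p (τ (toℕ x)) ≡ y → ¬ (cx q (σ (toℕ y)) ≡ x)
    no-swap-XY p q x y x<i y<j cy≡y cx≡x = Bool.not-¬ refl (trans σ≡τ τ≡notσ)
      where
      α β : Bool
      α = σ (toℕ y)
      β = τ (toℕ x)
      a≤q : a ≤ toℕ q
      a≤q = cx<i⇒a≤p q α (subst (λ z → toℕ z < i) (sym cx≡x) x<i)
      b≤p : b ≤ toℕ p
      b≤p = cy<j⇒b≤p p β (subst (λ z → toℕ z < j) (sym cy≡y) y<j)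
      τ≡notσ : β ≡ not α
      τ≡notσ = trans (τ-inner x<i)
        (cong not (trans (cong (odd ∘ toℕ) (sym cx≡x)) (cx-inner-odd q α a≤q)))
      σ≡τ : α ≡ β
      σ≡τ = trans (cong (odd ∘ toℕ) (sym cy≡y)) (trans (cong odd (toℕ-cy-inner p β b≤p))
        (g-odd (ℕ.≤-<-trans a≤q (Fin.toℕ<n q)) _ β))

    no-swap : ∀ p q u v → InS u → InS v → parent p u ≡ v → ¬ (parent q v ≡ u)
    no-swap p q (inj₁ x) (inj₂ y) x<i y<j eq eq′ =
      no-swap-XY p q x y x<i y<j (inj₂-injective eq) (inj₁-injective eq′)
    no-swap p q (inj₂ y) (inj₁ x) y<j x<i eq eq′ =
      no-swap-XY q p x y x<i y<j (inj₂-injective eq′) (inj₁-injective eq)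

    adj-parent : ∀ p w → inX (i + a) (j + b) (enc w) ≢ inX (i + a) (j + b) (enc (parent p w))
    adj-parent p (inj₁ x) rewrite dec-enc (inj₁ x) | dec-enc (parent p (inj₁ x)) = λ ()
    adj-parent p (inj₂ y) rewrite dec-enc (inj₂ y) | dec-enc (parent p (inj₂ y)) = λ ()

    Child : Fin k → V → V → Set
    Child p u v = (InS u ⊎ Centre p u) × u ≢ root p × parent p u ≡ v

    x₀ : Fin (i + a)
    x₀ = fromℕ< (ℕ.<-≤-trans 0<i (ℕ.m≤m+n i a))

    x₀<i : toℕ x₀ < i
    x₀<i = subst (_< i) (sym (Fin.toℕ-fromℕ< _)) 0<i

    y₀ : Fin (j + b)
    y₀ = fromℕ< (ℕ.<-≤-trans 0<j (ℕ.m≤m+n j b))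

    y₀<j : toℕ y₀ < j
    y₀<j = subst (_< j) (sym (Fin.toℕ-fromℕ< _)) 0<j

    -- This supplies a child to a spare centre in X. Vertex 0 of Y serves unless it is the root; in
    -- that case the root lies in `S`, so `b ≤ p < a`, and `1<j` makes vertex 1 available.
    other-Y : ∀ p → toℕ p < a → ∃[ y ] (toℕ y < j × y ≢ cy p false)
    other-Y p p<a with toℕ (cy p false) ≟ 0
    ... | no  c≢0 = y₀ , y₀<j ,
      λ eq → c≢0 (trans (cong toℕ (sym eq)) (Fin.toℕ-fromℕ< _))
    ... | yes c≡0 = fromℕ< 1<j+b , subst (_< j) (sym (Fin.toℕ-fromℕ< _)) 1<j′ ,
      λ eq → ℕ.1+n≢0 (trans (sym (Fin.toℕ-fromℕ< 1<j+b)) (trans (cong toℕ eq) c≡0))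
      where
      b≤p : b ≤ toℕ p
      b≤p = cy<j⇒b≤p p false (subst (_< j) (sym c≡0) 0<j)
      1<j′ : 1 < j
      1<j′ = 1<j (ℕ.≤-<-trans b≤p p<a)
      1<j+b : 1 < j + b
      1<j+b = ℕ.<-≤-trans 1<j′ (ℕ.m≤m+n j b)

    spare-twoNeighbours : ∀ p w → Centre p w → ¬ InS w →
      ∃[ u ] ∃[ v ] (u ≢ v × (Child p w u ⊎ Child p u w) × (Child p w v ⊎ Child p v w))
    spare-twoNeighbours p (inj₁ x) (α , refl) x≮i with cx≮i⇒p<a p α x≮i
    ... | p<a with other-Y p p<a
    -- The root is the parent, as `τ` vanishes off `S`; `y` is a child whatever its parity, as X_p^0
    -- = X_p^1.
    ...   | y , y<j , y≢ = root p , inj₂ y , (λ { refl → y≢ refl }) ,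
      inj₁ (inj₂ (α , refl) , (λ ()) , cong (inj₂ ∘ cy p) (τ-spare x≮i)) ,
      inj₂ (inj₁ y<j , (λ { refl → y≢ refl }) , cong inj₁ (cx-spare p _ α p<a))
    -- Here `p < b ≤ a`, so the tree has one spare centre on each side. The one in Y is the root,
    -- with children `x₀` in `S` and the centre in X outside `S`.
    spare-twoNeighbours p (inj₂ y) (β , refl) y≮j =
      inj₁ x₀ , inj₁ (cx p false) , (λ eq → x≮i (subst (λ x → toℕ x < i) (inj₁-injective eq) x₀<i)) ,
      inj₂ (inj₁ x₀<i , (λ ()) , cong inj₂ (cy-spare p _ β p<b)) ,
      inj₂ (inj₂ (false , refl) , (λ ()) , cong inj₂ (cy-spare p _ β p<b))
      where
      p<b : toℕ p < b
      p<b = cy≮j⇒p<b p β y≮j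
      x≮i : ¬ (toℕ (cx p false) < i)
      x≮i x<i = ℕ.<⇒≱ (ℕ.<-≤-trans p<b b≤a) (cx<i⇒a≤p p false x<i)

    2≤∣S∣ : 2 ≤ ∣ S ∣
    2≤∣S∣ = two-members⇒2≤∣p∣ (∈S⁺ (inj₁ x₀) x₀<i) (∈S⁺ (inj₂ y₀) y₀<j)
      (λ eq → inj₁≢inj₂ (trans (sym (dec-enc (inj₁ x₀))) (trans (cong dec eq) (dec-enc (inj₂ y₀)))))
      where
      inj₁≢inj₂ : inj₁ x₀ ≢ inj₂ y₀
      inj₁≢inj₂ ()

    ≢-dec : ∀ {v w} → v ≢ enc w → dec v ≢ w
    ≢-dec v≢ refl = v≢ (sym (enc-dec _))

    module F = Family (K (i + a) (j + b)) S
      (λ p → Centre p ∘ dec) (λ p → centre? p ∘ dec)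
      (enc ∘ root) (λ p → enc ∘ parent p ∘ dec) (λ p → rank p ∘ dec)
      (λ p → subst (Centre p) (sym (dec-enc (root p))) (false , refl))
      (λ p v → subst (Centre p) (sym (dec-enc (parent p (dec v)))) (centre-parent p (dec v)))
      (λ p v v≢ → subst (λ w → rank p w < rank p (dec v)) (sym (dec-enc (parent p (dec v))))
        (rank-parent p (dec v) (≢-dec v≢)))
      (λ p v → subst (λ u → inX (i + a) (j + b) u ≢ inX (i + a) (j + b) (enc (parent p (dec v))))
        (enc-dec v) (adj-parent p (dec v)))
      (centre-unique ∘ dec)
      (λ p q u v u∈ v∈ eq eq′ → no-swap p q (dec u) (dec v)
        (∈S⁻ (dec u) (subst (_∈ S) (sym (enc-dec u)) u∈))
        (∈S⁻ (dec v) (subst (_∈ S) (sym (enc-dec v)) v∈))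
        (trans (sym (dec-enc _)) (cong dec eq)) (trans (sym (dec-enc _)) (cong dec eq′)))

    child-enc : ∀ p u v → Child p u v → F.Child p (enc u) (enc v)
    child-enc p u v (u∈ , u≢root , eq) = vertex u∈ ,
      (λ e → u≢root (trans (sym (dec-enc u)) (trans (cong dec e) (dec-enc _)))) ,
      cong enc (trans (cong (parent p) (dec-enc u)) eq)
      where
      vertex : InS u ⊎ Centre p u → enc u ∈ S ⊎ Centre p (dec (enc u))
      vertex (inj₁ u∈S) = inj₁ (∈S⁺ u u∈S)
      vertex (inj₂ c)   = inj₂ (subst (Centre p) (sym (dec-enc u)) c)

    spare-enc : ∀ p w → Centre p w → enc w ∉ S → ∃[ u ] ∃[ v ] (u ≢ v ×
      (F.Child p (enc w) u ⊎ F.Child p u (enc w)) × (F.Child p (enc w) v ⊎ F.Child p v (enc w)))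
    spare-enc p w c w∉ with spare-twoNeighbours p w c (w∉ ∘ ∈S⁺ w)
    ... | u , v , u≢v , l , l′ = enc u , enc v ,
      (λ eq → u≢v (trans (sym (dec-enc u)) (trans (cong dec eq) (dec-enc v)))) , link l , link l′
      where
      link : ∀ {u} → Child p w u ⊎ Child p u w → F.Child p (enc w) (enc u) ⊎ F.Child p (enc u) (enc w)
      link = map⊎ (child-enc p _ _) (child-enc p _ _)

  k≤κ* : k ≤ κ* (K (i + a) (j + b)) (Sᵢ (i + a) (j + b) (i + j) i)
  k≤κ* = proj₂ (κ*-isMaximum (K (i + a) (j + b)) S 2≤∣S∣) k
    (F.hasFamily (λ p v c v∉ → subst
      (λ z → z ∉ S → ∃[ u ] ∃[ v ] (u ≢ v ×
        (F.Child p z u ⊎ F.Child p u z) × (F.Child p z v ⊎ F.Child p v z)))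
      (enc-dec v) (spare-enc p (dec v) c) v∉))

-- The two families of trees

n≤m∧m<n+o⇒m∸n<o : ∀ {m n o} → n ≤ m → m < n + o → m ∸ n < o
n≤m∧m<n+o⇒m∸n<o {m} {n} {o} n≤m m<n+o =
  ℕ.+-cancelˡ-< n (m ∸ n) o (subst (_< n + o) (sym (ℕ.m+[n∸m]≡n n≤m)) m<n+o)

module _ (i j b c : ℕ) (0<i : 0 < i) (0<j : 0 < j) (i+c≤j : i + c ≤ j) where

  private
    1<j : b < b + c → 1 < j
    1<j b<b+c = ℕ.≤-trans (ℕ.+-mono-≤ 0<i 0<c) i+c≤j
      where
      0<c : 0 < c
      0<c = ℕ.+-cancelˡ-< b 0 c (subst (_< b + c) (sym (ℕ.+-identityʳ b)) b<b+c)

    h : ℕ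
    h = (i + c) / 2

    h*2≤i+c : h * 2 ≤ i + c
    h*2≤i+c = m/n*n≤m (i + c) 2

    κ*ᵢ : ℕ
    κ*ᵢ = κ* (K (i + (b + c)) (j + b)) (Sᵢ (i + (b + c)) (j + b) (i + j) i)

  -- With `k = a` every centre in X is spare, and the conditions on trees from `a` on are vacuous.
  -- The trees from `b` on take one vertex of `S` in Y each, and `c ≤ j` leaves room.
  b+c≤κ* : b + c ≤ κ*ᵢ
  b+c≤κ* = CompleteBipartite.k≤κ* i j (b + c) b (b + c) 0<i 0<j (ℕ.m≤m+n b c) 1<j
    (λ p _ a≤p p<a → contradiction a≤p (ℕ.<⇒≱ p<a))
    (λ t _ → t)
    (λ p _ b≤p p<b+c → ℕ.<-≤-trans (n≤m∧m<n+o⇒m∸n<o b≤p p<b+c) (ℕ.m+n≤o⇒n≤o i i+c≤j))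
    (λ _ _ r≡t → r≡t)
    (λ _ → inj₁ refl)
    (λ a<a → contradiction a<a (ℕ.<-irrefl refl))

  -- The trees from `b` on take `h` disjoint pairs in Y, which fit because `h * 2 ≤ i + c ≤ j`.
  b+⌊[i+c]/2⌋≤κ* : b + h ≤ κ*ᵢ
  b+⌊[i+c]/2⌋≤κ* = CompleteBipartite.k≤κ* i j (b + c) b (b + h) 0<i 0<j (ℕ.m≤m+n b c) 1<j
    (λ p α a≤p p<k → ℕ.<-≤-trans (bit+*2<suc*2 α (p ∸ (b + c))) (x-small p a≤p p<k))
    (λ t β → bit β + t * 2)
    (λ p β b≤p p<k → ℕ.<-≤-trans (bit+*2<suc*2 β (p ∸ b))
      (ℕ.≤-trans (ℕ.*-monoˡ-≤ 2 (n≤m∧m<n+o⇒m∸n<o b≤p p<k)) (ℕ.≤-trans h*2≤i+c i+c≤j)))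
    (λ α β → bit+*2-injective α β _ _)
    (λ t → inj₂ (odd-bit+*2 true t))
    (λ _ t β → odd-bit+*2 β t)
    where
    -- For p = b + c + r the bound on p gives r + 1 + c ≤ h, and doubling leaves room for r + 1
    -- pairs among the `i` vertices of `S` in X.
    x-small : ∀ p → b + c ≤ p → p < b + h → suc (p ∸ (b + c)) * 2 ≤ i
    x-small p a≤p p<k with r , refl ← ℕ.m≤n⇒∃[o]m+o≡n a≤p
      rewrite ℕ.m+n∸m≡n (b + c) r = ℕ.+-cancelʳ-≤ c (suc r * 2) i (begin
        suc r * 2 + c     ≤⟨ ℕ.+-monoʳ-≤ (suc r * 2) (ℕ.m≤m*n c 2) ⟩
        suc r * 2 + c * 2 ≡⟨ ℕ.*-distribʳ-+ 2 (suc r) c ⟨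
        (suc r + c) * 2   ≤⟨ ℕ.*-monoˡ-≤ 2 r+c<h ⟩
        h * 2             ≤⟨ h*2≤i+c ⟩
        i + c             ∎)
      where
      open ℕ.≤-Reasoning
      r+c<h : r + c < h
      r+c<h = ℕ.+-cancelˡ-< b (r + c) h (subst (_< b + h)
        (trans (ℕ.+-assoc b c r) (cong (b +_) (ℕ.+-comm c r))) p<k)

-- From the hypotheses to the parameters i, j, b, c

2i≤D⇒b≤a : ∀ i j a b → 0 < i → 2 * i ≤ (i + a + (i + j)) ∸ (j + b) → b ≤ a
2i≤D⇒b≤a i j a b 0<i 2i≤D with ℕ.≤-total (j + b) (i + a + (i + j))
-- A truncated difference would be 0, while `2 * i` is positive.
... | inj₂ D≤0 = contradiction (subst (2 * i ≤_) (ℕ.m≤n⇒m∸n≡0 D≤0) 2i≤D)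
  (ℕ.<⇒≱ (ℕ.<-≤-trans 0<i (ℕ.m≤m+n i (i + 0))))
-- Without truncation the bound reads 2i ≤ 2i + a - b.
... | inj₁ le = ℕ.+-cancelˡ-≤ (2 * i + j) b a (begin
  2 * i + j + b   ≡⟨ ℕ.+-assoc (2 * i) j b ⟩
  2 * i + (j + b) ≤⟨ ℕ.m≤o∸n⇒m+n≤o (2 * i) le 2i≤D ⟩
  i + a + (i + j) ≡⟨ solve 3 (λ i j a → i :+ a :+ (i :+ j) := con 2 :* i :+ j :+ a) refl i j a ⟩
  2 * i + j + a   ∎)
  where open ℕ.≤-Reasoning

i≤i+j∸1⇒0<j : ∀ i j → 0 < i → i ≤ i + j ∸ 1 → 0 < j
i≤i+j∸1⇒0<j (suc i) zero    _ i≤ = contradiction (subst (suc i ≤_) (ℕ.+-identityʳ i) i≤) ℕ.1+n≰n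
i≤i+j∸1⇒0<j (suc i) (suc j) _ _  = s≤s z≤n

record Parameters (m₁ m₂ s i : ℕ) : Set where
  field
    j b c : ℕ
    m₁≡   : m₁ ≡ i + (b + c)
    m₂≡   : m₂ ≡ j + b
    s≡    : s ≡ i + j
    0<i   : 0 < i
    0<j   : 0 < j
    i+c≤j : i + c ≤ j

-- Each parameter is the slack of an inequality: `a` of i ≤ m₁, `j` of i ≤ s, `b` of j ≤ m₂ (which
-- is s - m₂ ≤ i), and `c` of b ≤ a. Then m₁ ≤ m₂ becomes i + c ≤ j.
parameters : ∀ m₁ m₂ s i → m₁ ≤ m₂ → 1 ⊔ (s ∸ m₂) ≤ i → i ≤ m₁ ⊓ (s ∸ 1) →
             2 * i ≤ (m₁ + s) ∸ m₂ → Parameters m₁ m₂ s i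
parameters m₁ m₂ s i m₁≤m₂ 1⊔[s∸m₂]≤i i≤m₁⊓[s∸1] 2i≤D
  with 0<i ← ℕ.m⊔n≤o⇒m≤o 1 (s ∸ m₂) 1⊔[s∸m₂]≤i
  with i≤s∸1 ← ℕ.m≤n⊓o⇒m≤o m₁ _ i≤m₁⊓[s∸1]
  with a , refl ← ℕ.m≤n⇒∃[o]m+o≡n (ℕ.m≤n⊓o⇒m≤n m₁ _ i≤m₁⊓[s∸1])
  with j , refl ← ℕ.m≤n⇒∃[o]m+o≡n (ℕ.≤-trans i≤s∸1 (ℕ.m∸n≤m s 1))
  with b , refl ← ℕ.m≤n⇒∃[o]m+o≡n {j} {m₂} (ℕ.+-cancelˡ-≤ i j m₂
    (subst (i + j ≤_) (ℕ.+-comm m₂ i) (ℕ.≤-trans (ℕ.m≤n+m∸n (i + j) m₂)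
      (ℕ.+-monoʳ-≤ m₂ (ℕ.m⊔n≤o⇒n≤o 1 _ 1⊔[s∸m₂]≤i)))))
  with c , refl ← ℕ.m≤n⇒∃[o]m+o≡n (2i≤D⇒b≤a i j a b 0<i 2i≤D)
  = record
    { j = j ; b = b ; c = c ; m₁≡ = refl ; m₂≡ = refl ; s≡ = refl
    ; 0<i = 0<i ; 0<j = i≤i+j∸1⇒0<j i j 0<i i≤s∸1
    ; i+c≤j = ℕ.+-cancelʳ-≤ b (i + c) j (subst (_≤ j + b)
        (solve 3 (λ i b c → i :+ (b :+ c) := i :+ c :+ b) refl i b c) m₁≤m₂)
    }

-- m₂ - (s - i) is `b`, the number of spare vertices of Y, and m₁ + s - m₂ - i is `i + c`.
size-case₂ : ∀ i j b c →
  (j + b) ∸ ((i + j) ∸ i) + ((i + (b + c) + (i + j)) ∸ (j + b) ∸ i) / 2 ≡ b + (i + c) / 2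
size-case₂ i j b c rewrite ℕ.m+n∸m≡n i j | ℕ.m+n∸m≡n j b
  | solve 4 (λ i j b c → i :+ (b :+ c) :+ (i :+ j) := (j :+ b) :+ (i :+ (i :+ c))) refl i j b c
  | ℕ.m+n∸m≡n (j + b) (i + (i + c)) | ℕ.m+n∸m≡n i (i + c) = refl

κ*-bounds : ∀ {m₁ m₂ s i} → Parameters m₁ m₂ s i →
  m₁ ∸ i ≤ κ* (K m₁ m₂) (Sᵢ m₁ m₂ s i) ×
  (m₂ ∸ (s ∸ i)) + ((m₁ + s) ∸ m₂ ∸ i) / 2 ≤ κ* (K m₁ m₂) (Sᵢ m₁ m₂ s i)
κ*-bounds {i = i} record { j = j ; b = b ; c = c ; m₁≡ = refl ; m₂≡ = refl ; s≡ = refl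
                         ; 0<i = 0<i ; 0<j = 0<j ; i+c≤j = i+c≤j } =
  ℕ.≤-trans (ℕ.≤-reflexive (ℕ.m+n∸m≡n i (b + c))) (b+c≤κ* i j b c 0<i 0<j i+c≤j) ,
  ℕ.≤-trans (ℕ.≤-reflexive (size-case₂ i j b c)) (b+⌊[i+c]/2⌋≤κ* i j b c 0<i 0<j i+c≤j)

theorem3p6 : (m₁ m₂ s i : ℕ) →
    2 ≤ m₁ → m₁ ≤ m₂ →
    1 ⊔ (s ∸ m₂) ≤ i → i ≤ m₁ ⊓ (s ∸ 1) →
    (m₂ ∸ m₁) + 3 ≤ s →
    2 ≤ 2 * i → 2 * i ≤ (m₁ + s) ∸ m₂ →
    (3 * (2 * i) ≤ 2 * ((m₁ + s) ∸ m₂) →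
    m₁ ∸ i ≤ κ* (K m₁ m₂) (Sᵢ m₁ m₂ s i))
    ×
    (2 * ((m₁ + s) ∸ m₂) < 3 * (2 * i) →
    (m₂ ∸ (s ∸ i)) + ((m₁ + s) ∸ m₂ ∸ i) / 2 ≤ κ* (K m₁ m₂) (Sᵢ m₁ m₂ s i))
theorem3p6 m₁ m₂ s i _ m₁≤m₂ 1⊔[s∸m₂]≤i i≤m₁⊓[s∸1] _ _ 2i≤D =
  (λ _ → proj₁ bounds) , (λ _ → proj₂ bounds)
  where
  bounds = κ*-bounds (parameters m₁ m₂ s i m₁≤m₂ 1⊔[s∸m₂]≤i i≤m₁⊓[s∸1] 2i≤D)
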